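{- Let $\alpha\in[0,1]$, let $G$ be a simple undirected graph on $n$ vertices, and let $H$ be a subgraph of $G$. Let $x\in\mathbb{R}^n$ and $\lambda\in\mathbb{R}$ satisfy $B(G)x=\lambda x$, and let $\lambda'$ be some scalar. Then the following are equivalent: (1) $B(H)x=\lambda' x$; (2) $B(G-H)x=(\lambda-\lambda')x$; (3) for all vertices $i$ of $G$, $$\alpha\sum_{j:\{i,j\}\in E(H)}x_j+(1-\alpha)\sum_{j:\{i,j\}\in E(H)}(x_i-x_j)=\lambda' x_i;$$ (4) for all vertices $i$ of $G$, $$\alpha\sum_{j:\{i,j\}\in E(G)\setminus E(H)}x_j+(1-\alpha)\sum_{j:\{i,j\}\in E(G)\setminus E(H)}(x_i-x_j)=(\lambda-\lambda')x_i.$$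
   Context: For a graph $G$ on $n$ vertices, $A(G)$ is the adjacency matrix, $D(G)$ the diagonal degree matrix, $L(G)=D(G)-A(G)$ the Laplacian, and $B(G)=B_\alpha(G)=\alpha A(G)+(1-\alpha)L(G)$. A subgraph $H$ of $G$ satisfies $V(H)\subseteq V(G)$ and $E(H)\subseteq E(G)$. $G-H$ denotes the graph with vertex set $V(G)$ obtained by removing the edges $E(H)$ from $E(G)$. $B(H)$ is regarded as an $n\times n$ matrix indexed by $V(G)$ (vertices of $G$ not in $H$ are treated as isolated), so that $B(G)=B(H)+B(G-H)$. -}

module Defs where

open import Algebra.Bundles using (CommutativeRing)
import Algebra.Definitions.RawMonoid as RawMonoidDefs
open import Algebra.Structures using (IsCommutativeRing)
open import Data.Bool.Base using (if_then_else_)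
open import Data.Fin.Base using (Fin)
open import Data.Fin.Properties using () renaming (_≟_ to _≟ᶠ_)
open import Data.Fin.Subset using (Subset; _∈_)
open import Data.List.Base using (List; allFin; filter; foldr; length; map)
open import Data.Nat.Base as ℕ using (ℕ)
import Data.Nat.Properties as ℕₚ
open import Data.Product.Base using (_×_; _,_; ∃; ∃₂; proj₁; proj₂)
open import Data.Rational.Base as ℚ using (ℚ; 0ℚ; 1ℚ; ½)
import Data.Rational.Properties as ℚₚ
open import Data.Rational.Solver using (module +-*-Solver)
open import Data.Vec.Functional using (Vector)
open import Level using (0ℓ)
open import Relation.Binary.Core using (Rel)
open import Relation.Binary.Definitions using (Decidable; Irreflexive; Symmetric)
open import Relation.Binary.Structures using (IsEquivalence)
open import Relation.Binary.PropositionalEquality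
  using (_≡_; refl; sym; trans; cong; cong₂; subst)
open import Relation.Nullary.Decidable using (does; ¬?; _×-dec_)
open import Relation.Nullary.Negation using (¬_)
import Relation.Unary as U

dist : ℚ → ℚ → ℚ
dist p q = ℚ.∣ p ℚ.- q ∣

dist-refl : ∀ p → dist p p ≡ 0ℚ
dist-refl p = cong ℚ.∣_∣ (ℚₚ.+-inverseʳ p)

dist-sym : ∀ p q → dist p q ≡ dist q p
dist-sym p q = trans (cong ℚ.∣_∣ flip) (ℚₚ.∣-p∣≡∣p∣ (q ℚ.- p))
  where
  open +-*-Solver
  flip : p ℚ.- q ≡ ℚ.- (q ℚ.- p)
  flip = solve 2 (λ p q → p :- q := :- (q :- p)) refl p q

dist-triangle : ∀ p q r → dist p r ℚ.≤ dist p q ℚ.+ dist q r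
dist-triangle p q r =
  subst (λ t → ℚ.∣ t ∣ ℚ.≤ dist p q ℚ.+ dist q r) split
    (ℚₚ.∣p+q∣≤∣p∣+∣q∣ (p ℚ.- q) (q ℚ.- r))
  where
  open +-*-Solver
  split : (p ℚ.- q) ℚ.+ (q ℚ.- r) ≡ p ℚ.- r
  split = solve 3 (λ p q r → (p :- q) :+ (q :- r) := p :- r) refl p q r

dist-neg : ∀ p q → dist (ℚ.- p) (ℚ.- q) ≡ dist p q
dist-neg p q = trans (cong ℚ.∣_∣ flip) (dist-sym q p)
  where
  open +-*-Solver
  flip : (ℚ.- p) ℚ.- (ℚ.- q) ≡ q ℚ.- p
  flip = solve 2 (λ p q → (:- p) :- (:- q) := q :- p) refl p q

dist-+ : ∀ a b c d → dist (a ℚ.+ b) (c ℚ.+ d) ℚ.≤ dist a c ℚ.+ dist b d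
dist-+ a b c d =
  subst (λ t → ℚ.∣ t ∣ ℚ.≤ dist a c ℚ.+ dist b d) split
    (ℚₚ.∣p+q∣≤∣p∣+∣q∣ (a ℚ.- c) (b ℚ.- d))
  where
  open +-*-Solver
  split : (a ℚ.- c) ℚ.+ (b ℚ.- d) ≡ (a ℚ.+ b) ℚ.- (c ℚ.+ d)
  split = solve 4 (λ a b c d → (a :- c) :+ (b :- d) := (a :+ b) :- (c :+ d))
            refl a b c d

dist-* : ∀ a b c d →
  dist (a ℚ.* b) (c ℚ.* d) ℚ.≤ ℚ.∣ a ∣ ℚ.* dist b d ℚ.+ ℚ.∣ d ∣ ℚ.* dist a c
dist-* a b c d = begin
  dist (a ℚ.* b) (c ℚ.* d)
    ≡⟨ cong ℚ.∣_∣ split ⟩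
  ℚ.∣ a ℚ.* (b ℚ.- d) ℚ.+ d ℚ.* (a ℚ.- c) ∣
    ≤⟨ ℚₚ.∣p+q∣≤∣p∣+∣q∣ (a ℚ.* (b ℚ.- d)) (d ℚ.* (a ℚ.- c)) ⟩
  ℚ.∣ a ℚ.* (b ℚ.- d) ∣ ℚ.+ ℚ.∣ d ℚ.* (a ℚ.- c) ∣
    ≡⟨ cong₂ ℚ._+_ (ℚₚ.∣p*q∣≡∣p∣*∣q∣ a (b ℚ.- d))
                   (ℚₚ.∣p*q∣≡∣p∣*∣q∣ d (a ℚ.- c)) ⟩
  ℚ.∣ a ∣ ℚ.* dist b d ℚ.+ ℚ.∣ d ∣ ℚ.* dist a c ∎
  where
  open ℚₚ.≤-Reasoning
  open +-*-Solver
  split : (a ℚ.* b) ℚ.- (c ℚ.* d) ≡ a ℚ.* (b ℚ.- d) ℚ.+ d ℚ.* (a ℚ.- c)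
  split = solve 4 (λ a b c d →
            (a :* b) :- (c :* d) := a :* (b :- d) :+ d :* (a :- c)) refl a b c d

halve : ∀ {ε} → 0ℚ ℚ.< ε → 0ℚ ℚ.< ½ ℚ.* ε
halve {ε} 0<ε = ℚₚ.positive⁻¹ (½ ℚ.* ε) {{ℚₚ.pos*pos⇒pos ½ ε {{ℚ.positive 0<ε}}}}

halves : ∀ ε → ½ ℚ.* ε ℚ.+ ½ ℚ.* ε ≡ ε
halves ε = trans (sym (ℚₚ.*-distribʳ-+ ε ½ ½)) (ℚₚ.*-identityˡ ε)

+-halves : ∀ {p q ε} → p ℚ.< ½ ℚ.* ε → q ℚ.< ½ ℚ.* ε → p ℚ.+ q ℚ.< ε
+-halves {ε = ε} p< q< = subst (_ ℚ.<_) (halves ε) (ℚₚ.+-mono-< p< q<)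

scale : ∀ {K ε} → 0ℚ ℚ.< K → 0ℚ ℚ.< ε →
  ∃ λ δ → 0ℚ ℚ.< δ × (∀ {a d} → ℚ.∣ a ∣ ℚ.≤ K → ℚ.∣ d ∣ ℚ.< δ →
                         ℚ.∣ a ∣ ℚ.* ℚ.∣ d ∣ ℚ.< ε)
scale {K} {ε} 0<K 0<ε = δ , ℚₚ.positive⁻¹ δ , bound
  where
  instance
    K-pos : ℚ.Positive K
    K-pos = ℚ.positive 0<K
    K-nonZero : ℚ.NonZero K
    K-nonZero = ℚₚ.pos⇒nonZero K
    ε-pos : ℚ.Positive ε
    ε-pos = ℚ.positive 0<ε
    1/K-pos : ℚ.Positive (ℚ.1/ K)
    1/K-pos = ℚₚ.1/pos⇒pos K
  δ : ℚ
  δ = (ℚ.1/ K) ℚ.* ε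
  instance
    δ-pos : ℚ.Positive δ
    δ-pos = ℚₚ.pos*pos⇒pos (ℚ.1/ K) ε
  Kδ≡ε : K ℚ.* δ ≡ ε
  Kδ≡ε = trans (sym (ℚₚ.*-assoc K (ℚ.1/ K) ε))
           (trans (cong (ℚ._* ε) (ℚₚ.*-inverseʳ K)) (ℚₚ.*-identityˡ ε))
  bound : ∀ {a d} → ℚ.∣ a ∣ ℚ.≤ K → ℚ.∣ d ∣ ℚ.< δ → ℚ.∣ a ∣ ℚ.* ℚ.∣ d ∣ ℚ.< ε
  bound {a} {d} a≤K d<δ = subst (ℚ.∣ a ∣ ℚ.* ℚ.∣ d ∣ ℚ.<_) Kδ≡ε
    (ℚₚ.≤-<-trans
      (ℚₚ.*-monoʳ-≤-nonNeg ℚ.∣ d ∣ {{ℚₚ.∣-∣-nonNeg d}} a≤K)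
      (ℚₚ.*-monoʳ-<-pos K d<δ))

-- Cauchy sequences of rationals carrying a modulus of convergence; equality of
-- reals is the setoid relation _≈ʳ_, not _≡_.
record ℝ : Set where
  constructor mkℝ
  field
    seq    : ℕ → ℚ
    cauchy : ∀ {ε} → 0ℚ ℚ.< ε →
             ∃ λ N → ∀ {m n} → N ℕ.≤ m → N ℕ.≤ n → dist (seq m) (seq n) ℚ.< ε

open ℝ

infix 4 _≈ʳ_ _≤ʳ_

record _≈ʳ_ (x y : ℝ) : Set where
  constructor mk≈
  field
    close : ∀ {ε} → 0ℚ ℚ.< ε →
            ∃ λ N → ∀ {n} → N ℕ.≤ n → dist (seq x n) (seq y n) ℚ.< ε

open _≈ʳ_

record _≤ʳ_ (x y : ℝ) : Set where
  constructor mk≤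
  field
    below : ∀ {ε} → 0ℚ ℚ.< ε →
            ∃ λ N → ∀ {n} → N ℕ.≤ n → seq x n ℚ.< seq y n ℚ.+ ε

private
  ⊔-left : ∀ {M N n} → M ℕ.⊔ N ℕ.≤ n → M ℕ.≤ n
  ⊔-left {M} {N} = ℕₚ.≤-trans (ℕₚ.m≤m⊔n M N)

  ⊔-right : ∀ {M N n} → M ℕ.⊔ N ℕ.≤ n → N ℕ.≤ n
  ⊔-right {M} {N} = ℕₚ.≤-trans (ℕₚ.m≤n⊔m M N)

≗⇒≈ʳ : ∀ {x y} → (∀ n → seq x n ≡ seq y n) → x ≈ʳ y
≗⇒≈ʳ {x} {y} eq = mk≈ λ {ε} 0<ε → 0 , λ {n} _ →
  subst (ℚ._< ε)
    (sym (trans (cong (λ t → dist t (seq y n)) (eq n)) (dist-refl (seq y n)))) 0<ε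

≈ʳ-isEquivalence : IsEquivalence _≈ʳ_
≈ʳ-isEquivalence = record
  { refl  = ≗⇒≈ʳ λ _ → refl
  ; sym   = λ {x} {y} x≈y → mk≈ λ {ε} 0<ε → let N , p = close x≈y 0<ε in
      N , λ {n} N≤n → subst (ℚ._< ε) (dist-sym (seq x n) (seq y n)) (p N≤n)
  ; trans = λ {x} {y} {z} x≈y y≈z → mk≈ λ 0<ε →
      let M , p = close x≈y (halve 0<ε)
          N , q = close y≈z (halve 0<ε)
      in M ℕ.⊔ N , λ {n} MN≤n →
           ℚₚ.≤-<-trans (dist-triangle (seq x n) (seq y n) (seq z n))
             (+-halves (p (⊔-left MN≤n)) (q (⊔-right {M} MN≤n)))
  }

fromℚ : ℚ → ℝ
fromℚ q = mkℝ (λ _ → q) λ {ε} 0<ε →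
  0 , λ _ _ → subst (ℚ._< ε) (sym (dist-refl q)) 0<ε

0ʳ 1ʳ : ℝ
0ʳ = fromℚ 0ℚ
1ʳ = fromℚ 1ℚ

infixl 6 _+ʳ_
infixl 7 _*ʳ_
infix  8 -ʳ_

_+ʳ_ : ℝ → ℝ → ℝ
x +ʳ y = mkℝ (λ n → seq x n ℚ.+ seq y n) λ 0<ε →
  let M , p = cauchy x (halve 0<ε)
      N , q = cauchy y (halve 0<ε)
  in M ℕ.⊔ N , λ {m} {n} ≤m ≤n →
       ℚₚ.≤-<-trans (dist-+ (seq x m) (seq y m) (seq x n) (seq y n))
         (+-halves (p (⊔-left ≤m) (⊔-left ≤n))
                   (q (⊔-right {M} ≤m) (⊔-right {M} ≤n)))

-ʳ_ : ℝ → ℝ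
-ʳ x = mkℝ (λ n → ℚ.- seq x n) λ {ε} 0<ε →
  let N , p = cauchy x 0<ε
  in N , λ {m} {n} ≤m ≤n →
       subst (ℚ._< ε) (sym (dist-neg (seq x m) (seq x n))) (p ≤m ≤n)

eventuallyBounded : ∀ x → ∃₂ λ K N →
  0ℚ ℚ.< K × (∀ {n} → N ℕ.≤ n → ℚ.∣ seq x n ∣ ℚ.≤ K)
eventuallyBounded x = K , N , 0<K , bound
  where
  0<1 : 0ℚ ℚ.< 1ℚ
  0<1 = ℚₚ.positive⁻¹ 1ℚ
  N : ℕ
  N = proj₁ (cauchy x 0<1)
  K : ℚ
  K = 1ℚ ℚ.+ ℚ.∣ seq x N ∣
  0<K : 0ℚ ℚ.< K
  0<K = ℚₚ.+-mono-<-≤ 0<1 (ℚₚ.nonNegative⁻¹ ℚ.∣ seq x N ∣ {{ℚₚ.∣-∣-nonNeg (seq x N)}})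
  split : ∀ p q → (p ℚ.- q) ℚ.+ q ≡ p
  split = solve 2 (λ p q → (p :- q) :+ q := p) refl
    where open +-*-Solver
  bound : ∀ {n} → N ℕ.≤ n → ℚ.∣ seq x n ∣ ℚ.≤ K
  bound {n} N≤n = begin
    ℚ.∣ seq x n ∣
      ≡⟨ cong ℚ.∣_∣ (sym (split (seq x n) (seq x N))) ⟩
    ℚ.∣ (seq x n ℚ.- seq x N) ℚ.+ seq x N ∣
      ≤⟨ ℚₚ.∣p+q∣≤∣p∣+∣q∣ (seq x n ℚ.- seq x N) (seq x N) ⟩
    dist (seq x n) (seq x N) ℚ.+ ℚ.∣ seq x N ∣
      ≤⟨ ℚₚ.+-monoˡ-≤ ℚ.∣ seq x N ∣
           (ℚₚ.<⇒≤ (proj₂ (cauchy x 0<1) N≤n ℕₚ.≤-refl)) ⟩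
    K ∎
    where open ℚₚ.≤-Reasoning

_*ʳ_ : ℝ → ℝ → ℝ
x *ʳ y = mkℝ (λ n → seq x n ℚ.* seq y n) λ 0<ε →
  let K  , M  , 0<K  , ∣x∣≤K  = eventuallyBounded x
      K′ , M′ , 0<K′ , ∣y∣≤K′ = eventuallyBounded y
      _ , 0<δ  , small  = scale 0<K  (halve 0<ε)
      _ , 0<δ′ , small′ = scale 0<K′ (halve 0<ε)
      N  , p = cauchy y 0<δ
      N′ , q = cauchy x 0<δ′
  in (M ℕ.⊔ M′) ℕ.⊔ (N ℕ.⊔ N′) , λ {m} {n} ≤m ≤n →
       ℚₚ.≤-<-trans (dist-* (seq x m) (seq y m) (seq x n) (seq y n))
         (+-halves
           (small {seq x m} {seq y m ℚ.- seq y n} (∣x∣≤K (⊔-left (⊔-left ≤m)))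
              (p (⊔-left (⊔-right {M ℕ.⊔ M′} ≤m)) (⊔-left (⊔-right {M ℕ.⊔ M′} ≤n))))
           (small′ {seq y n} {seq x m ℚ.- seq x n}
              (∣y∣≤K′ (⊔-right {M} (⊔-left ≤n)))
              (q (⊔-right {N} (⊔-right {M ℕ.⊔ M′} ≤m))
                 (⊔-right {N} (⊔-right {M ℕ.⊔ M′} ≤n)))))

+ʳ-cong : ∀ {x x′ y y′} → x ≈ʳ x′ → y ≈ʳ y′ → x +ʳ y ≈ʳ x′ +ʳ y′
+ʳ-cong {x} {x′} {y} {y′} x≈ y≈ = mk≈ λ 0<ε →
  let M , p = close x≈ (halve 0<ε)
      N , q = close y≈ (halve 0<ε)
  in M ℕ.⊔ N , λ {n} ≤n →
       ℚₚ.≤-<-trans (dist-+ (seq x n) (seq y n) (seq x′ n) (seq y′ n))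
         (+-halves (p (⊔-left ≤n)) (q (⊔-right {M} ≤n)))

-ʳ-cong : ∀ {x y} → x ≈ʳ y → -ʳ x ≈ʳ -ʳ y
-ʳ-cong {x} {y} x≈y = mk≈ λ {ε} 0<ε →
  let N , p = close x≈y 0<ε
  in N , λ {n} ≤n → subst (ℚ._< ε) (sym (dist-neg (seq x n) (seq y n))) (p ≤n)

*ʳ-cong : ∀ {x x′ y y′} → x ≈ʳ x′ → y ≈ʳ y′ → x *ʳ y ≈ʳ x′ *ʳ y′
*ʳ-cong {x} {x′} {y} {y′} x≈ y≈ = mk≈ λ 0<ε →
  let K  , M  , 0<K  , ∣x∣≤K   = eventuallyBounded x
      K′ , M′ , 0<K′ , ∣y′∣≤K′ = eventuallyBounded y′
      _ , 0<δ  , small  = scale 0<K  (halve 0<ε)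
      _ , 0<δ′ , small′ = scale 0<K′ (halve 0<ε)
      N  , p = close y≈ 0<δ
      N′ , q = close x≈ 0<δ′
  in (M ℕ.⊔ M′) ℕ.⊔ (N ℕ.⊔ N′) , λ {n} ≤n →
       ℚₚ.≤-<-trans (dist-* (seq x n) (seq y n) (seq x′ n) (seq y′ n))
         (+-halves
           (small {seq x n} {seq y n ℚ.- seq y′ n} (∣x∣≤K (⊔-left (⊔-left ≤n)))
              (p (⊔-left (⊔-right {M ℕ.⊔ M′} ≤n))))
           (small′ {seq y′ n} {seq x n ℚ.- seq x′ n}
              (∣y′∣≤K′ (⊔-right {M} (⊔-left ≤n)))
              (q (⊔-right {N} (⊔-right {M ℕ.⊔ M′} ≤n)))))

ℝ-isCommutativeRing : IsCommutativeRing _≈ʳ_ _+ʳ_ _*ʳ_ -ʳ_ 0ʳ 1ʳ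
ℝ-isCommutativeRing = record
  { isRing = record
    { +-isAbelianGroup = record
      { isGroup = record
        { isMonoid = record
          { isSemigroup = record
            { isMagma = record
              { isEquivalence = ≈ʳ-isEquivalence
              ; ∙-cong        = +ʳ-cong
              }
            ; assoc = λ x y z → ≗⇒≈ʳ λ n → ℚₚ.+-assoc (seq x n) (seq y n) (seq z n)
            }
          ; identity = (λ x → ≗⇒≈ʳ λ n → ℚₚ.+-identityˡ (seq x n))
                     , (λ x → ≗⇒≈ʳ λ n → ℚₚ.+-identityʳ (seq x n))
          }
        ; inverse = (λ x → ≗⇒≈ʳ λ n → ℚₚ.+-inverseˡ (seq x n))
                  , (λ x → ≗⇒≈ʳ λ n → ℚₚ.+-inverseʳ (seq x n))
        ; ⁻¹-cong = -ʳ-cong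
        }
      ; comm = λ x y → ≗⇒≈ʳ λ n → ℚₚ.+-comm (seq x n) (seq y n)
      }
    ; *-cong     = *ʳ-cong
    ; *-assoc    = λ x y z → ≗⇒≈ʳ λ n → ℚₚ.*-assoc (seq x n) (seq y n) (seq z n)
    ; *-identity = (λ x → ≗⇒≈ʳ λ n → ℚₚ.*-identityˡ (seq x n))
                 , (λ x → ≗⇒≈ʳ λ n → ℚₚ.*-identityʳ (seq x n))
    ; distrib    =
        (λ x y z → ≗⇒≈ʳ λ n → ℚₚ.*-distribˡ-+ (seq x n) (seq y n) (seq z n))
      , (λ x y z → ≗⇒≈ʳ λ n → ℚₚ.*-distribʳ-+ (seq x n) (seq y n) (seq z n))
    }
  ; *-comm = λ x y → ≗⇒≈ʳ λ n → ℚₚ.*-comm (seq x n) (seq y n)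
  }

ℝ-commutativeRing : CommutativeRing 0ℓ 0ℓ
ℝ-commutativeRing = record { isCommutativeRing = ℝ-isCommutativeRing }

-- A simple graph with vertex set Fin n; {i , j} is an edge iff Adj i j holds.
record Graph (n : ℕ) : Set₁ where
  field
    Adj        : Rel (Fin n) 0ℓ
    Adj?       : Decidable Adj
    Adj-sym    : Symmetric Adj
    Adj-irrefl : Irreflexive _≡_ Adj

record Subgraph {n : ℕ} (G : Graph n) : Set₁ where
  private module G = Graph G
  field
    vertices   : Subset n
    Adj        : Rel (Fin n) 0ℓ
    Adj?       : Decidable Adj
    Adj-sym    : Symmetric Adj
    Adj⇒vertex : ∀ {i j} → Adj i j → i ∈ vertices
    Adj⇒G      : ∀ {i j} → Adj i j → G.Adj i j

-- H as a graph on all of V(G): the vertices outside H become isolated.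
padded : ∀ {n} {G : Graph n} → Subgraph G → Graph n
padded {G = G} H = record
  { Adj        = H.Adj
  ; Adj?       = H.Adj?
  ; Adj-sym    = H.Adj-sym
  ; Adj-irrefl = λ i≡j ij → Graph.Adj-irrefl G i≡j (H.Adj⇒G ij)
  }
  where module H = Subgraph H

infixl 6 _∖_

-- Removes only the edges of H; the vertex set is unchanged.
_∖_ : ∀ {n} (G : Graph n) → Subgraph G → Graph n
G ∖ H = record
  { Adj        = λ i j → G.Adj i j × ¬ H.Adj i j
  ; Adj?       = λ i j → G.Adj? i j ×-dec ¬? (H.Adj? i j)
  ; Adj-sym    = λ (ij∈G , ij∉H) → G.Adj-sym ij∈G , λ ji∈H → ij∉H (H.Adj-sym ji∈H)
  ; Adj-irrefl = λ i≡j (ij∈G , _) → G.Adj-irrefl i≡j ij∈G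
  }
  where
  module G = Graph G
  module H = Subgraph H

neighbours : ∀ {n} → Graph n → Fin n → List (Fin n)
neighbours {n} G i = filter (Graph.Adj? G i) (allFin n)

degree : ∀ {n} → Graph n → Fin n → ℕ
degree G i = length (neighbours G i)

module GraphMatrices {c ℓ} (R : CommutativeRing c ℓ) where

  open CommutativeRing R hiding (refl; sym; trans)
  open RawMonoidDefs +-rawMonoid using (sum) renaming (_×_ to _·_)

  Matrix : ℕ → Set c
  Matrix n = Fin n → Fin n → Carrier

  infixr 7 _*ᵥ_ _∙ᵥ_
  infix  4 _≈ᵥ_

  _*ᵥ_ : ∀ {n} → Matrix n → Vector Carrier n → Vector Carrier n
  (M *ᵥ x) i = sum λ j → M i j * x j

  _∙ᵥ_ : ∀ {n} → Carrier → Vector Carrier n → Vector Carrier n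
  (s ∙ᵥ x) i = s * x i

  _≈ᵥ_ : ∀ {n} → Rel (Vector Carrier n) ℓ
  x ≈ᵥ y = ∀ i → x i ≈ y i

  sumOver : ∀ {n p} {P : U.Pred (Fin n) p} →
            U.Decidable P → (Fin n → Carrier) → Carrier
  sumOver {n} P? f = foldr _+_ 0# (map f (filter P? (allFin n)))

  infix 5 sumOver
  syntax sumOver P? (λ j → e) = ∑[ j ∣ P? ] e

  adjacencyMatrix : ∀ {n} → Graph n → Matrix n
  adjacencyMatrix G i j = if does (Graph.Adj? G i j) then 1# else 0#

  degreeMatrix : ∀ {n} → Graph n → Matrix n
  degreeMatrix G i j = if does (i ≟ᶠ j) then degree G i · 1# else 0#

  laplacian : ∀ {n} → Graph n → Matrix n
  laplacian G i j = degreeMatrix G i j - adjacencyMatrix G i j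

  B : ∀ {n} → Carrier → Graph n → Matrix n
  B α G i j = α * adjacencyMatrix G i j + (1# - α) * laplacian G i j

open GraphMatrices ℝ-commutativeRing public
open CommutativeRing ℝ-commutativeRing public
  using (_≈_; _+_; _*_; _-_; 0#; 1#)

{-# OPTIONS --safe #-}

-- For every graph K, the i-th entry of B(K)x is the edge sum of (3) taken over K,
-- because the degree times x i is the sum of x i over the neighbours of i. Hence
-- (1) is (3) and (2) is (4). The edges of G split into those of H and those of
-- G ∖ H, so the edge sums of H and G ∖ H at i add up to μ * x i, which makes (3)
-- and (4) complementary.

module Submission where

open import Algebra.Bundles using (CommutativeRing)
open import Data.Bool.Base using (if_then_else_)
open import Data.Fin.Base using (Fin; zero; suc)
open import Data.Fin.Properties using (_≟_)
open import Data.List.Base using (List; []; _∷_; filter; foldr; length; map; tabulate)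
open import Data.Nat.Base using (ℕ; zero; suc)
open import Data.Product.Base using (_×_; _,_)
open import Data.Vec.Functional using (Vector)
open import Function.Base using (id; _∘_; _$_)
open import Function.Bundles using (_⇔_; mk⇔)
open import Function.Construct.Composition using (_⇔-∘_)
open import Function.Construct.Symmetry using (⇔-sym)
open import Level using (0ℓ; _⊔_) renaming (suc to lsuc)
open import Relation.Nullary.Decidable using (Dec; yes; no; does; ¬?; _×-dec_)
open import Relation.Nullary.Negation using (contradiction)
open import Relation.Unary using (Pred; Decidable)

import Algebra.Properties.CommutativeSemigroup
import Algebra.Properties.Ring
import Algebra.Properties.Semiring.Sum
import Relation.Binary.Reasoning.Setoid

open import Defs using (Graph; Subgraph; padded; _∖_; neighbours; degree; module GraphMatrices)

module EdgeSums {c ℓ} (R : CommutativeRing c ℓ) where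

  open CommutativeRing R hiding (zero)
  open GraphMatrices R
  open Algebra.Properties.Ring ring using (x≈z//y; //-rightDividesˡ; +-cancelʳ; x[y-z]≈xy-xz; [y-z]x≈yx-zx; -‿distribˡ-*)
  open Algebra.Properties.Semiring.Sum semiring
    using (sum; sum-cong-≋; ∑-distrib-+; *-distribˡ-sum)
  open import Algebra.Definitions.RawMonoid +-rawMonoid using () renaming (_×_ to _·_)
  open Algebra.Properties.CommutativeSemigroup +-commutativeSemigroup using (interchange)
  open Relation.Binary.Reasoning.Setoid setoid

  -- Neighbour sums as indicator sums

  -- Has the shape of an adjacency matrix entry: `adjacencyMatrix K i j` unfolds to the indicator of
  -- `Graph.Adj? K i j`, so indicator sums are also matrix row products.
  indicator : ∀ {p} {P : Set p} → Dec P → Carrier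
  indicator P? = if does P? then 1# else 0#

  -- Generalised from `allFin n`, which is `tabulate id`, to an arbitrary `g`, because the induction
  -- passes from `g` to `g ∘ suc`.
  foldr-filter-tabulate : ∀ {a p n} {A : Set a} {P : Pred A p} (P? : Decidable P)
    (f : A → Carrier) (g : Fin n → A) →
    foldr _+_ 0# (map f (filter P? (tabulate g))) ≈ sum (λ j → indicator (P? (g j)) * f (g j))
  foldr-filter-tabulate {n = zero}  P? f g = refl
  foldr-filter-tabulate {n = suc n} P? f g with P? (g zero)
  ... | yes _ = +-cong (sym (*-identityˡ _)) (foldr-filter-tabulate P? f (g ∘ suc))
  ... | no  _ = begin
    foldr _+_ 0# (map f (filter P? (tabulate (g ∘ suc))))      ≈⟨ foldr-filter-tabulate P? f (g ∘ suc) ⟩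
    rest                                                       ≈⟨ +-identityˡ _ ⟨
    0# + rest                                                  ≈⟨ +-congʳ (zeroˡ _) ⟨
    0# * f (g zero) + rest                                     ∎
    where rest = sum λ j → indicator (P? (g (suc j))) * f (g (suc j))

  sumOver≈sum : ∀ {n p} {P : Pred (Fin n) p} (P? : Decidable P) (f : Fin n → Carrier) →
    sumOver P? f ≈ sum (λ j → indicator (P? j) * f j)
  sumOver≈sum P? f = foldr-filter-tabulate P? f id

  -- The indicators already add up for each `j`; the inclusion of `Q` in `P` rules out the one bad
  -- case. The decision procedure for the difference is the one that `G ∖ H` carries.
  sumOver-difference : ∀ {n p q} {P : Pred (Fin n) p} {Q : Pred (Fin n) q}
    (P? : Decidable P) (Q? : Decidable Q) → (∀ {j} → Q j → P j) → ∀ f →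
    sumOver P? f ≈ sumOver Q? f + sumOver (λ j → P? j ×-dec ¬? (Q? j)) f
  sumOver-difference P? Q? Q⊆P f = begin
    sumOver P? f                                   ≈⟨ sumOver≈sum P? f ⟩
    sum (λ j → indicator (P? j) * f j)             ≈⟨ sum-cong-≋ split ⟩
    sum (λ j → indicator (Q? j) * f j + indicator (P∖Q? j) * f j)
      ≈⟨ ∑-distrib-+ (λ j → indicator (Q? j) * f j) (λ j → indicator (P∖Q? j) * f j) ⟩
    sum (λ j → indicator (Q? j) * f j) + sum (λ j → indicator (P∖Q? j) * f j)
      ≈⟨ +-cong (sumOver≈sum Q? f) (sumOver≈sum P∖Q? f) ⟨
    sumOver Q? f + sumOver P∖Q? f                  ∎
    where
    P∖Q? = λ j → P? j ×-dec ¬? (Q? j)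

    split : ∀ j → indicator (P? j) * f j ≈ indicator (Q? j) * f j + indicator (P∖Q? j) * f j
    split j with P? j | Q? j
    ... | yes _  | yes _  = sym (trans (+-congˡ (zeroˡ _)) (+-identityʳ _))
    ... | yes _  | no  _  = sym (trans (+-congʳ (zeroˡ _)) (+-identityˡ _))
    ... | no  ¬p | yes q  = contradiction (Q⊆P q) ¬p
    ... | no  _  | no  _  = sym (trans (+-congˡ (zeroˡ _)) (+-identityʳ _))

  -- Diagonal entries and degrees

  sum-zeroˡ : ∀ {n} (x : Vector Carrier n) → sum (λ j → 0# * x j) ≈ 0#
  sum-zeroˡ x = trans (sym (*-distribˡ-sum 0# x)) (zeroˡ _)

  -- Induction on `i`: the test `suc i ≟ suc j` has the same truth value as `i ≟ j` by computation,
  -- so the tail is the same sum one size smaller.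
  sum-diagonal : ∀ {n} (d : Carrier) (x : Vector Carrier n) (i : Fin n) →
    sum (λ j → (if does (i ≟ j) then d else 0#) * x j) ≈ d * x i
  sum-diagonal d x zero    = trans (+-congˡ (sum-zeroˡ (x ∘ suc))) (+-identityʳ _)
  sum-diagonal d x (suc i) =
    trans (+-congʳ (zeroˡ _)) (trans (+-identityˡ _) (sum-diagonal d (x ∘ suc) i))

  -- Turns a degree into a sum over neighbours: `s` is added once for each list entry.
  length·1*-≈-foldr-const : ∀ {a} {A : Set a} (js : List A) (s : Carrier) →
    (length js · 1#) * s ≈ foldr _+_ 0# (map (λ _ → s) js)
  length·1*-≈-foldr-const []       s = zeroˡ s
  length·1*-≈-foldr-const (_ ∷ js) s =
    trans (distribʳ s 1# (length js · 1#)) (+-cong (*-identityˡ s) (length·1*-≈-foldr-const js s))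

  -- Edge sums and the action of B

  -- Unfolds to the left side of (3) for `padded H` and to that of (4) for `G ∖ H`.
  edgeSum : ∀ {n} → Carrier → Graph n → Vector Carrier n → Vector Carrier n
  edgeSum α K x i = α * (∑[ j ∣ Graph.Adj? K i ] x j)
                  + (1# - α) * (∑[ j ∣ Graph.Adj? K i ] (x i - x j))

  degreeMatrix-*ᵥ : ∀ {n} (K : Graph n) (x : Vector Carrier n) (i : Fin n) →
    (degreeMatrix K *ᵥ x) i ≈ sum (λ j → adjacencyMatrix K i j * x i)
  degreeMatrix-*ᵥ K x i = begin
    (degreeMatrix K *ᵥ x) i                        ≈⟨ sum-diagonal (degree K i · 1#) x i ⟩
    (degree K i · 1#) * x i                        ≈⟨ length·1*-≈-foldr-const (neighbours K i) (x i) ⟩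
    sumOver (Graph.Adj? K i) (λ _ → x i)           ≈⟨ sumOver≈sum (Graph.Adj? K i) (λ _ → x i) ⟩
    sum (λ j → adjacencyMatrix K i j * x i)        ∎

  -- Apart from the degree part, the two sides agree term by term. The terms `d j * x j` and
  -- `a j * x i` agree only after summation over `j`, so the degree part is isolated in a sum of its
  -- own, exchanged, and merged back.
  B-*ᵥ : ∀ {n} (α : Carrier) (K : Graph n) (x : Vector Carrier n) → B α K *ᵥ x ≈ᵥ edgeSum α K x
  B-*ᵥ α K x i = begin
    (B α K *ᵥ x) i                                 ≈⟨ sum-cong-≋ (λ j → expand (a j) (d j) (x j)) ⟩
    sum (λ j → α * (a j * x j) + β * (d j * x j + - a j * x j))
      ≈⟨ sum-cong-≋ (λ j → regroup (a j * x j) (d j * x j) (- a j * x j)) ⟩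
    sum (λ j → u j + β * (d j * x j))              ≈⟨ ∑-distrib-+ u (λ j → β * (d j * x j)) ⟩
    sum u + sum (λ j → β * (d j * x j))            ≈⟨ +-congˡ (*-distribˡ-sum β (λ j → d j * x j)) ⟨
    sum u + β * sum (λ j → d j * x j)              ≈⟨ +-congˡ (*-congˡ (degreeMatrix-*ᵥ K x i)) ⟩
    sum u + β * sum (λ j → a j * x i)              ≈⟨ +-congˡ (*-distribˡ-sum β (λ j → a j * x i)) ⟩
    sum u + sum (λ j → β * (a j * x i))            ≈⟨ ∑-distrib-+ u (λ j → β * (a j * x i)) ⟨
    -- The first regrouping is now undone with `a j * x i` in the place of `d j * x j`, which leaves
    -- the difference `x i - x j` to be factored out.
    sum (λ j → u j + β * (a j * x i))              ≈⟨ sum-cong-≋ (λ j → regroup (a j * x j) (a j * x i) (- a j * x j)) ⟨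
    sum (λ j → α * (a j * x j) + β * (a j * x i + - a j * x j))
      ≈⟨ sum-cong-≋ (λ j → +-congˡ (*-congˡ (factor (a j) (x i) (x j)))) ⟩
    sum (λ j → α * (a j * x j) + β * (a j * (x i - x j)))
      ≈⟨ ∑-distrib-+ (λ j → α * (a j * x j)) (λ j → β * (a j * (x i - x j))) ⟩
    sum (λ j → α * (a j * x j)) + sum (λ j → β * (a j * (x i - x j)))
      ≈⟨ +-cong (*-distribˡ-sum α (λ j → a j * x j)) (*-distribˡ-sum β (λ j → a j * (x i - x j))) ⟨
    α * sum (λ j → a j * x j) + β * sum (λ j → a j * (x i - x j))
      ≈⟨ +-cong (*-congˡ (sumOver≈sum (Graph.Adj? K i) x))
                (*-congˡ (sumOver≈sum (Graph.Adj? K i) (λ j → x i - x j))) ⟨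
    edgeSum α K x i                                ∎
    where
    β = 1# - α
    a = adjacencyMatrix K i
    d = degreeMatrix K i
    u = λ j → α * (a j * x j) + β * (- a j * x j)

    expand : ∀ a d y → (α * a + β * (d - a)) * y ≈ α * (a * y) + β * (d * y + - a * y)
    expand a d y = begin
      (α * a + β * (d - a)) * y                    ≈⟨ distribʳ y (α * a) (β * (d - a)) ⟩
      α * a * y + β * (d - a) * y                  ≈⟨ +-cong (*-assoc α a y) (*-assoc β (d - a) y) ⟩
      α * (a * y) + β * ((d - a) * y)              ≈⟨ +-congˡ (*-congˡ (distribʳ y d (- a))) ⟩
      α * (a * y) + β * (d * y + - a * y)          ∎

    regroup : ∀ r s t → α * r + β * (s + t) ≈ (α * r + β * t) + β * s
    regroup r s t = begin
      α * r + β * (s + t)              ≈⟨ +-congˡ (distribˡ β s t) ⟩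
      α * r + (β * s + β * t)          ≈⟨ +-congˡ (+-comm (β * s) (β * t)) ⟩
      α * r + (β * t + β * s)          ≈⟨ +-assoc (α * r) (β * t) (β * s) ⟨
      (α * r + β * t) + β * s          ∎

    factor : ∀ a y z → a * y + - a * z ≈ a * (y - z)
    factor a y z = begin
      a * y + - a * z      ≈⟨ +-congˡ (-‿distribˡ-* a z) ⟨
      a * y - a * z        ≈⟨ x[y-z]≈xy-xz a y z ⟨
      a * (y - z)          ∎

  -- Both neighbour sums split along the edges of `H`, and `interchange` collects the two `H` parts
  -- and the two remaining parts.
  edgeSum-∖ : ∀ {n} (α : Carrier) (G : Graph n) (H : Subgraph G) (x : Vector Carrier n) (i : Fin n) →
    edgeSum α G x i ≈ edgeSum α (padded H) x i + edgeSum α (G ∖ H) x i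
  edgeSum-∖ α G H x i = begin
    edgeSum α G x i
      ≈⟨ +-cong (*-congˡ (split x)) (*-congˡ (split (λ j → x i - x j))) ⟩
    α * (inH x + outH x) + (1# - α) * (inH (λ j → x i - x j) + outH (λ j → x i - x j))
      ≈⟨ +-cong (distribˡ α _ _) (distribˡ (1# - α) _ _) ⟩
    (α * inH x + α * outH x) + ((1# - α) * inH (λ j → x i - x j) + (1# - α) * outH (λ j → x i - x j))
      ≈⟨ interchange (α * inH x) (α * outH x) _ _ ⟩
    edgeSum α (padded H) x i + edgeSum α (G ∖ H) x i
      ∎
    where
    inH outH : (Fin _ → Carrier) → Carrier
    inH  = sumOver (Subgraph.Adj? H i)
    outH = sumOver (Graph.Adj? (G ∖ H) i)

    split : ∀ f → sumOver (Graph.Adj? G i) f ≈ inH f + outH f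
    split = sumOver-difference (Graph.Adj? G i) (Subgraph.Adj? H i) (Subgraph.Adj⇒G H)

  -- Complementary eigenvalue equations

  ≈ᵥ-congˡ : ∀ {n} {x y z : Vector Carrier n} → x ≈ᵥ y → (x ≈ᵥ z) ⇔ (y ≈ᵥ z)
  ≈ᵥ-congˡ x≈y = mk⇔ (λ x≈z i → trans (sym (x≈y i)) (x≈z i)) (λ y≈z i → trans (x≈y i) (y≈z i))

  complementary-summands : ∀ {s t y} (μ μ′ : Carrier) → s + t ≈ μ * y →
    (s ≈ μ′ * y → t ≈ (μ - μ′) * y) × (t ≈ (μ - μ′) * y → s ≈ μ′ * y)
  complementary-summands {s} {t} {y} μ μ′ s+t≈μy = to , from
    where
    to : s ≈ μ′ * y → t ≈ (μ - μ′) * y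
    to s≈μ′y = begin
      t                    ≈⟨ x≈z//y t s (μ * y) (trans (+-comm t s) s+t≈μy) ⟩
      μ * y - s            ≈⟨ +-congˡ (-‿cong s≈μ′y) ⟩
      μ * y - μ′ * y       ≈⟨ [y-z]x≈yx-zx y μ μ′ ⟨
      (μ - μ′) * y         ∎

    from : t ≈ (μ - μ′) * y → s ≈ μ′ * y
    -- Writing `μ` as `(μ - μ′) + μ′` exhibits `t` as a summand of `μ * y`, so that it can be
    -- cancelled.
    from t≈ = +-cancelʳ t s (μ′ * y) $ begin
      s + t                      ≈⟨ s+t≈μy ⟩
      μ * y                      ≈⟨ *-congʳ (//-rightDividesˡ μ′ μ) ⟨
      ((μ - μ′) + μ′) * y        ≈⟨ distribʳ y (μ - μ′) μ′ ⟩
      (μ - μ′) * y + μ′ * y      ≈⟨ +-comm _ _ ⟩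
      μ′ * y + (μ - μ′) * y      ≈⟨ +-congˡ t≈ ⟨
      μ′ * y + t                 ∎

  edgeSum-eigen-⇔ : ∀ {n} (α : Carrier) (G : Graph n) (H : Subgraph G) (x : Vector Carrier n) (μ μ′ : Carrier) →
    B α G *ᵥ x ≈ᵥ μ ∙ᵥ x →
    (edgeSum α (padded H) x ≈ᵥ μ′ ∙ᵥ x) ⇔ (edgeSum α (G ∖ H) x ≈ᵥ (μ - μ′) ∙ᵥ x)
  edgeSum-eigen-⇔ α G H x μ μ′ Bx≈μx = mk⇔
    (λ h i → let to , _ = complementary-summands μ μ′ (total i) in to (h i))
    (λ h i → let _ , from = complementary-summands μ μ′ (total i) in from (h i))
    where
    -- The equation `B α G *ᵥ x ≈ᵥ μ ∙ᵥ x` enters here, fixing the total of the two edge sums at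
    -- each vertex.
    total : ∀ i → edgeSum α (padded H) x i + edgeSum α (G ∖ H) x i ≈ μ * x i
    total i = trans (sym (edgeSum-∖ α G H x i)) (trans (sym (B-*ᵥ α G x i)) (Bx≈μx i))

  -- The operations occurring nested in the theorem are parameters. A record type is
  -- compared parameter by parameter, so at ℝ only the bare operations get unfolded;
  -- comparing the applied terms would unfold the Cauchy moduli of all nested products.
  record SubgraphEquivalences (n : ℕ)
    (_⊗_ _⊖_ : Carrier → Carrier → Carrier) (𝟏 : Carrier) (B′ : Carrier → Graph n → Matrix n)
    (sumOver′ : (P : Pred (Fin n) 0ℓ) → Decidable P → (Fin n → Carrier) → Carrier) :
    Set (lsuc 0ℓ ⊔ c ⊔ ℓ) where
    field
      equivalences :
        ∀ (α : Carrier) (G : Graph n) (H : Subgraph G) (x : Vector Carrier n) (μ : Carrier) →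
        B′ α G *ᵥ x ≈ᵥ μ ∙ᵥ x →
        ∀ (μ′ : Carrier) →
        let
          H-Adj? = Subgraph.Adj? H
          K-Adj? = λ i k → Graph.Adj? G i k ×-dec ¬? (H-Adj? i k)
          ⟨1⟩ = B′ α (padded H) *ᵥ x ≈ᵥ μ′ ∙ᵥ x
          ⟨2⟩ = B′ α (G ∖ H) *ᵥ x ≈ᵥ (μ ⊖ μ′) ∙ᵥ x
          ⟨3⟩ = ∀ i →
                  (α ⊗ sumOver′ _ (H-Adj? i) x) + ((𝟏 ⊖ α) ⊗ sumOver′ _ (H-Adj? i) (λ j → x i ⊖ x j))
                  ≈ μ′ ⊗ x i
          ⟨4⟩ = ∀ i →
                  (α ⊗ sumOver′ _ (K-Adj? i) x) + ((𝟏 ⊖ α) ⊗ sumOver′ _ (K-Adj? i) (λ j → x i ⊖ x j))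
                  ≈ (μ ⊖ μ′) ⊗ x i
        in (⟨1⟩ ⇔ ⟨2⟩) × (⟨2⟩ ⇔ ⟨3⟩) × (⟨3⟩ ⇔ ⟨4⟩)

  subgraphEquivalences : ∀ n → SubgraphEquivalences n _*_ _-_ 1# B (λ P → sumOver {P = P})
  subgraphEquivalences n = record { equivalences = λ α G H x μ Bx≈μx μ′ →
    let
      1⇔3 = ≈ᵥ-congˡ {z = μ′ ∙ᵥ x} (B-*ᵥ α (padded H) x)
      2⇔4 = ≈ᵥ-congˡ {z = (μ - μ′) ∙ᵥ x} (B-*ᵥ α (G ∖ H) x)
      3⇔4 = edgeSum-eigen-⇔ α G H x μ μ′ Bx≈μx
    -- Composition reads from right to left: the paths are (1), (3), (4), (2) and then (2), (4),
    -- (3).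
    in ⇔-sym 2⇔4 ⇔-∘ (3⇔4 ⇔-∘ 1⇔3) , ⇔-sym 3⇔4 ⇔-∘ 2⇔4 , 3⇔4 }

-- The case of the real numbers

open import Defs

-- Here the generic operations are matched with the real ones as record parameters, so that the
-- projected field is already stated with the operations of the theorem.
ℝ-subgraphEquivalences : ∀ n →
  EdgeSums.SubgraphEquivalences ℝ-commutativeRing n _*_ _-_ 1# B (λ P → sumOver {P = P})
ℝ-subgraphEquivalences = EdgeSums.subgraphEquivalences ℝ-commutativeRing

theorem3p4 :
    ∀ (α : ℝ) → 0# ≤ʳ α → α ≤ʳ 1# →
    ∀ (n : ℕ) (G : Graph n) (H : Subgraph G) →
    ∀ (x : Vector ℝ n) (μ : ℝ) → B α G *ᵥ x ≈ᵥ μ ∙ᵥ x →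
    ∀ (μ′ : ℝ) →
    let
      G-Adj? = Graph.Adj? G
      H-Adj? = Subgraph.Adj? H
      ⟨1⟩ = B α (padded H) *ᵥ x ≈ᵥ μ′ ∙ᵥ x
      ⟨2⟩ = B α (G ∖ H) *ᵥ x ≈ᵥ (μ - μ′) ∙ᵥ x
      ⟨3⟩ = ∀ (i : Fin n) →
              α * (∑[ j ∣ H-Adj? i ] x j)
                + (1# - α) * (∑[ j ∣ H-Adj? i ] (x i - x j))
              ≈ μ′ * x i
      ⟨4⟩ = ∀ (i : Fin n) →
              α * (∑[ j ∣ (λ k → G-Adj? i k ×-dec ¬? (H-Adj? i k)) ] x j)
                + (1# - α) * (∑[ j ∣ (λ k → G-Adj? i k ×-dec ¬? (H-Adj? i k)) ] (x i - x j))
              ≈ (μ - μ′) * x i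
    in (⟨1⟩ ⇔ ⟨2⟩) × (⟨2⟩ ⇔ ⟨3⟩) × (⟨3⟩ ⇔ ⟨4⟩)
theorem3p4 α _ _ n = EdgeSums.SubgraphEquivalences.equivalences (ℝ-subgraphEquivalences n) α
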